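{- Let $k$ be a positive integer. Let $G=(V,E,\partial)$ be a finite undirected graph with $V$ the disjoint union of $\{v_1,v_2,v_3,v_4\}$ (four distinct vertices) and a (possibly empty) set $Y$, such that every vertex $y\in Y$ has even degree in $G$. If after the deletion of any $k-1$ or fewer edges from $G$ there still exists a chain of edges $p$ with $\partial(p)=v_1+v_2+v_3+v_4$, then there exist $k$ chains of edges $p_1,\ldots,p_k$ in $G$, no two of which have a common nontrivial summand, such that $\partial(p_1)=\cdots=\partial(p_k)=v_1+v_2+v_3+v_4$.
   Context: A graph $G=(V,E,\partial)$ consists of a finite nonempty vertex set $V$, a finite edge set $E$, and a map $\partial$ assigning to each edge a set of exactly two distinct vertices (parallel edges allowed, no loops). The degree of a vertex $v$ is the number of edges $e$ with $v\in\partial(e)$. $A(S)$ is the $\mathbb{F}_2$-vector space of formal $\mathbb{F}_2$-linear combinations of elements of $S$; elements of $A(E)$ are chains of edges, with summands the edges of coefficient $1$. Two chains have no common nontrivial summand if no edge is a summand of both. $\partial$ extends $\mathbb{F}_2$-linearly to $A(E)\to A(V)$, sending an edge to the sum of its two endpoints. Deleting edges means removing them from $E$ (the vertex set is unchanged). -}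

module Defs where

open import Data.Nat using (ℕ; zero; suc; _+_)
open import Data.Fin using (Fin; zero; suc; _≟_)
open import Data.Bool using (Bool; true; false; _∧_; _∨_; _xor_; if_then_else_)
open import Data.Product using (_×_; proj₁; proj₂)
open import Relation.Binary.PropositionalEquality using (_≡_; _≢_)
open import Relation.Nullary.Decidable using (⌊_⌋)

-- A finite multigraph without loops: vertices Fin nV, edges Fin nE,
-- ∂ e = {proj₁ (ends e), proj₂ (ends e)}, two distinct vertices.
record Graph : Set where
  field
    nV : ℕ
    nE : ℕ
    ends : Fin nE → Fin nV × Fin nV
    loopless : ∀ e → proj₁ (ends e) ≢ proj₂ (ends e)
open Graph public

xorSum : ∀ {n} → (Fin n → Bool) → Bool
xorSum {zero} f = false
xorSum {suc n} f = f zero xor xorSum (λ i → f (suc i))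

count : ∀ {n} → (Fin n → Bool) → ℕ
count {zero} f = 0
count {suc n} f = (if f zero then 1 else 0) + count (λ i → f (suc i))

-- A(S) for S = Fin n: F₂-linear combinations = coefficient functions
A : ℕ → Set
A n = Fin n → Bool

δ : ∀ {n} → Fin n → A n
δ s v = ⌊ s ≟ v ⌋

_⊕_ : ∀ {n} → A n → A n → A n
(a ⊕ b) v = a v xor b v
infixl 6 _⊕_

incident : (G : Graph) → Fin (nE G) → Fin (nV G) → Bool
incident G e v = ⌊ proj₁ (ends G e) ≟ v ⌋ ∨ ⌊ proj₂ (ends G e) ≟ v ⌋

degree : (G : Graph) → Fin (nV G) → ℕ
degree G v = count (λ e → incident G e v)

∂ : (G : Graph) → A (nE G) → A (nV G)
∂ G p v = xorSum (λ e → p e ∧ (δ (proj₁ (ends G e)) ⊕ δ (proj₂ (ends G e))) v)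

_≐_ : ∀ {n} → A n → A n → Set
a ≐ b = ∀ v → a v ≡ b v
infix 4 _≐_

-- a chain p is a chain of G with the edge set D deleted iff no summand of p lies in D
AvoidsEdges : ∀ {m} → A m → A m → Set
AvoidsEdges D p = ∀ e → D e ≡ true → p e ≡ false

NoCommonSummand : ∀ {m} → A m → A m → Set
NoCommonSummand p q = ∀ e → p e ≡ true → q e ≡ false

{-# OPTIONS --safe #-}
module Submission where

-- Let T = {v₁, v₂, v₃, v₄}. By hypothesis every T-odd cut has at least k edges. As long as an
-- edge yu has an end y outside T, Lovász splitting applies: some edge yw can be merged with yu into
-- one edge uw so that all T-odd cuts keep at least k edges. Otherwise every candidate w would
-- lie with u in a T-odd set missing y and having at most k + 1 boundary edges; by submodularity
-- and parity such tight sets are closed under union, and adding y to the union of all of them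
-- gives a T-odd cut that is too small. A packing after the merge yields one before it.
-- When all edges run inside T, one removes either a perfect matching of T or, if none of
-- the three matchings exists, a star with three edges, and lowers k by one.

open import Defs
open import Data.Nat
  using (ℕ; zero; suc; _+_; _*_; _≤_; _<_; _≤?_; _<?_; _≡ᵇ_; s≤s⁻¹; z≤n; s≤s)
  renaming (_≟_ to _≟ℕ_)
open import Data.Nat.Properties hiding (_≟_)
open import Data.Nat.ListAction using (sum)
open import Data.Nat.ListAction.Properties using (sum-↭)
open import Data.Nat.Divisibility using (_∣_; divides)
open import Data.Bool using (Bool; true; false; not; _∧_; _∨_; _xor_; if_then_else_)
import Data.Bool.Properties as Bool
open import Algebra.Bundles using (CommutativeRing)
open import Data.Fin using (Fin; zero; suc; toℕ; _≟_)
open import Data.Fin.Properties using (toℕ<n; toℕ-injective)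
open import Data.Fin.Subset.Properties using (anySubset?)
open import Data.List using (List; []; _∷_; _++_; map; foldr; length; tabulate)
open import Data.List.Properties using (≡-dec; map-cong; map-cong-local; map-∘; map-id; ∷-injective)
open import Data.List.Membership.Propositional using (_∈_; _∉_)
import Data.List.Membership.DecPropositional as DecMembership
open import Data.List.Membership.Propositional.Properties using (∈-∃++)
open import Data.List.Relation.Unary.All as All using (All; []; _∷_)
open import Data.List.Relation.Unary.Any using (here; there)
open import Data.List.Relation.Unary.AllPairs using ([]; _∷_)
open import Data.List.Relation.Unary.Unique.Propositional using (Unique)
open import Data.List.Relation.Binary.Permutation.Propositional
  using (_↭_; ↭-refl; ↭-sym; ↭-trans; ↭-prep; ↭-swap; ↭⇒↭ₛ)
open import Data.List.Relation.Binary.Permutation.Propositional.Properties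
  using (All-resp-↭; ∈-resp-↭; ↭-map-inv; map⁺; shift; ↭-length)
import Data.List.Relation.Unary.All.Properties as All
import Data.List.Relation.Binary.Permutation.Setoid.Properties as ↭ₛ
open import Data.Product using (Σ; Σ-syntax; ∃-syntax; _×_; _,_; proj₁; proj₂; map₁)
open import Data.Sum using (_⊎_; inj₁; inj₂)
open import Data.Product.Properties using () renaming (≡-dec to ×-≡-dec)
import Data.Vec as Vec
open import Data.Vec.Properties using (lookup∘tabulate)
open import Function using (_∘_; case_of_; Equivalence)
open import Relation.Binary.PropositionalEquality
  using (_≡_; _≢_; _≗_; refl; sym; trans; cong; cong₂; subst; setoid; module ≡-Reasoning)
open import Relation.Nullary using (¬_; Dec; yes; no; contradiction)
open import Relation.Nullary.Decidable
  using (⌊_⌋; ⌊⌋-map′; map′; toWitness; _×-dec_; _⊎-dec_; _→-dec_; ¬?;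
         isYes≗does; dec-true; dec-false)
open import Relation.Unary using (Decidable)

-- Parity, exhaustive Boolean checks and lists.

bit : Bool → ℕ
bit b = if b then 1 else 0

odd : ℕ → Bool
odd zero    = false
odd (suc n) = not (odd n)

odd-+ : ∀ m n → odd (m + n) ≡ odd m xor odd n
odd-+ zero    n = refl
odd-+ (suc m) n = trans (cong not (odd-+ m n)) (Bool.not-distribˡ-xor (odd m) (odd n))

odd-bit : ∀ b → odd (bit b) ≡ b
odd-bit true  = refl
odd-bit false = refl

-- The only way to fail is `m` equal to `suc n`, which has the other parity. This turns
-- near-tightness of a cut into minimality among cuts of the same parity.
≤-of-≤suc-same-parity : ∀ {k m n} → m ≤ suc k → k ≤ n → odd m ≡ odd n → m ≤ n
≤-of-≤suc-same-parity {k} {m} {n} m≤1+k k≤n same with m ≤? n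
... | yes m≤n = m≤n
... | no  m≰n = contradiction (cong odd m≡1+n) (Bool.not-¬ same)
  where
  n<m : n < m
  n<m = ≰⇒> m≰n
  m≡1+n : m ≡ suc n
  m≡1+n = ≤-antisym (≤-trans m≤1+k (s≤s k≤n)) n<m

-- Decides Boolean statements by evaluating all cases; each `table` below is proved this way.
∀Bool? : {P : Bool → Set} → (∀ b → Dec (P b)) → Dec (∀ b → P b)
∀Bool? {P} P? = map′ (λ { (t , f) true → t ; (t , f) false → f }) (λ h → h true , h false)
                     (P? true ×-dec P? false)

extract : {A : Set} {P : A → Set} → Decidable P → (xs : List A) →
          (∃[ x ] ∃[ ys ] P x × xs ↭ x ∷ ys) ⊎ All (¬_ ∘ P) xs
extract P? [] = inj₂ []
extract P? (x ∷ xs) with P? x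
... | yes px = inj₁ (x , xs , px , ↭-refl)
... | no ¬px with extract P? xs
...   | inj₁ (y , ys , py , xs↭) =
  inj₁ (y , x ∷ ys , py , ↭-trans (↭-prep x xs↭) (↭-swap x y ↭-refl))
...   | inj₂ none = inj₂ (¬px ∷ none)

∈⇒↭ : {A : Set} {x : A} {xs : List A} → x ∈ xs → ∃[ ys ] xs ↭ x ∷ ys
∈⇒↭ x∈xs with ys , zs , refl ← ∈-∃++ x∈xs = ys ++ zs , shift _ ys zs

sum-map-+-mono : {A : Set} (f g f′ g′ : A → ℕ) → (∀ x → f x + g x ≤ f′ x + g′ x) → ∀ xs →
                 sum (map f xs) + sum (map g xs) ≤ sum (map f′ xs) + sum (map g′ xs)
sum-map-+-mono f g f′ g′ h [] = z≤n
sum-map-+-mono f g f′ g′ h (x ∷ xs) = begin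
  f x + F + (g x + G)     ≡⟨ interchange (f x) F (g x) G ⟩
  f x + g x + (F + G)     ≤⟨ +-mono-≤ (h x) (sum-map-+-mono f g f′ g′ h xs) ⟩
  f′ x + g′ x + (F′ + G′) ≡⟨ interchange (f′ x) (g′ x) F′ G′ ⟩
  f′ x + F′ + (g′ x + G′) ∎
  where
  open ≤-Reasoning
  open import Algebra.Properties.CommutativeSemigroup +-commutativeSemigroup using (interchange)
  F  = sum (map f xs)
  G  = sum (map g xs)
  F′ = sum (map f′ xs)
  G′ = sum (map g′ xs)

-- Cuts and submodularity

VSet : ℕ → Set
VSet n = Fin n → Bool

-- A multigraph is a list of such pairs. Loops are allowed because merging two edges may create one;
-- a loop crosses no cut.
Edge : ℕ → Set
Edge n = Fin n × Fin n

-- The arguments of `≟` are ordered so that `ind v s` is definitionally `δ s v`; thus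
-- `cut (ind v) e` is the coefficient of `v` in the boundary of `e`.
ind : ∀ {n} → Fin n → VSet n
ind y v = ⌊ v ≟ y ⌋

ind-≡ : ∀ {n} {v y : Fin n} → v ≡ y → ind y v ≡ true
ind-≡ {v = v} {y} v≡y = trans (isYes≗does (v ≟ y)) (dec-true (v ≟ y) v≡y)

ind-≢ : ∀ {n} {v y : Fin n} → v ≢ y → ind y v ≡ false
ind-≢ {v = v} {y} v≢y = trans (isYes≗does (v ≟ y)) (dec-false (v ≟ y) v≢y)

cut : ∀ {n} → VSet n → Edge n → Bool
cut χ e = χ (proj₁ e) xor χ (proj₂ e)

size : ∀ {n} → VSet n → List (Edge n) → ℕ
size χ L = sum (map (bit ∘ cut χ) L)

-- An edge matters only through the cuts that it crosses, so its ends are recorded that way and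
-- their order is forgotten.
Joins : ∀ {n} → Edge n → Fin n → Fin n → Set
Joins e u v = ∀ χ → cut χ e ≡ χ u xor χ v

module _ {n : ℕ} where

  size-↭ : ∀ (χ : VSet n) {L M} → L ↭ M → size χ L ≡ size χ M
  size-↭ χ L↭M = sum-↭ (map⁺ (bit ∘ cut χ) L↭M)

  size-cong : ∀ {χ ψ : VSet n} → χ ≗ ψ → ∀ L → size χ L ≡ size ψ L
  size-cong χ≗ψ [] = refl
  size-cong χ≗ψ ((u , v) ∷ L) =
    cong₂ _+_ (cong bit (cong₂ _xor_ (χ≗ψ u) (χ≗ψ v))) (size-cong χ≗ψ L)

  size-∁ : ∀ (χ : VSet n) L → size (not ∘ χ) L ≡ size χ L
  size-∁ χ [] = refl
  size-∁ χ ((u , v) ∷ L) =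
    cong₂ _+_ (cong bit (Bool.xor-annihilates-not (χ u) (χ v))) (size-∁ χ L)

  size-mono : ∀ {χ ψ : VSet n} {L} → All (λ e → cut χ e ≡ true → cut ψ e ≡ true) L →
              size χ L ≤ size ψ L
  size-mono [] = z≤n
  size-mono {χ} {ψ} {e ∷ L} (h ∷ hs) = +-mono-≤ (bit-mono (cut χ e) (cut ψ e) h) (size-mono {χ} {ψ} hs)
    where
    bit-mono : ∀ x y → (x ≡ true → y ≡ true) → bit x ≤ bit y
    bit-mono false y h = z≤n
    bit-mono true  y h = ≤-reflexive (cong bit (sym (h refl)))

  size-tail : ∀ (χ : VSet n) {L e M} → L ↭ e ∷ M → cut χ e ≡ false → size χ L ≡ size χ M
  size-tail χ {M = M} L↭ uncrossed = trans (size-↭ χ L↭) (cong (λ z → bit z + size χ M) uncrossed)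

  size-zero : ∀ {χ : VSet n} {L} → All (λ e → cut χ e ≡ false) L → size χ L ≡ 0
  size-zero [] = refl
  size-zero {χ} (h ∷ hs) = cong₂ _+_ (cong bit h) (size-zero {χ} hs)

  crossed-edge : ∀ (χ : VSet n) L → 1 ≤ size χ L → ∃[ e ] e ∈ L × cut χ e ≡ true
  crossed-edge χ (e ∷ L) h with cut χ e in eq
  ... | true  = e , here refl , eq
  ... | false with f , f∈L , cf ← crossed-edge χ L h = f , there f∈L , cf

_∩_ _∪_ _∖_ : ∀ {n} → VSet n → VSet n → VSet n
(χ ∩ ψ) v = χ v ∧ ψ v
(χ ∪ ψ) v = χ v ∨ ψ v
(χ ∖ ψ) v = χ v ∧ not (ψ v)

-- The inequality holds edge by edge, where it is a truth table in the memberships of the two ends.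
∩-∪-submodular : ∀ {n} (χ ψ : VSet n) L →
                 size (χ ∩ ψ) L + size (χ ∪ ψ) L ≤ size χ L + size ψ L
∩-∪-submodular χ ψ = sum-map-+-mono _ _ _ _ λ { (u , v) → table (χ u) (ψ u) (χ v) (ψ v) }
  where
  table : ∀ x x′ z z′ → bit ((x ∧ x′) xor (z ∧ z′)) + bit ((x ∨ x′) xor (z ∨ z′))
                      ≤ bit (x xor z) + bit (x′ xor z′)
  table = toWitness {a? = ∀Bool? λ _ → ∀Bool? λ _ → ∀Bool? λ _ → ∀Bool? λ _ → _ ≤? _} _

-- This is the previous inequality with `ψ` complemented, again checked edge by edge.
∖-submodular : ∀ {n} (χ ψ : VSet n) L →
               size (χ ∖ ψ) L + size (ψ ∖ χ) L ≤ size χ L + size ψ L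
∖-submodular χ ψ = sum-map-+-mono _ _ _ _ λ { (u , v) → table (χ u) (ψ u) (χ v) (ψ v) }
  where
  table : ∀ x x′ z z′ → bit ((x ∧ not x′) xor (z ∧ not z′)) + bit ((x′ ∧ not x) xor (z′ ∧ not z))
                      ≤ bit (x xor z) + bit (x′ xor z′)
  table = toWitness {a? = ∀Bool? λ _ → ∀Bool? λ _ → ∀Bool? λ _ → ∀Bool? λ _ → _ ≤? _} _

-- T-odd sets and the connectivity that they measure.

parity : List Bool → Bool
parity = foldr _xor_ false

-- The exhaustive check would otherwise be unfolded by every with-abstraction over the lemma.
abstract
  -- Up to complements, two odd subsets of a 4-set are nested or disjoint.
  odd-quadruples : ∀ x₁ x₂ x₃ x₄ y₁ y₂ y₃ y₄ →
    let xs = x₁ ∷ x₂ ∷ x₃ ∷ x₄ ∷ []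
        ys = y₁ ∷ y₂ ∷ y₃ ∷ y₄ ∷ []
        ms = (x₁ ∧ y₁) ∷ (x₂ ∧ y₂) ∷ (x₃ ∧ y₃) ∷ (x₄ ∧ y₄) ∷ []
        js = (x₁ ∨ y₁) ∷ (x₂ ∨ y₂) ∷ (x₃ ∨ y₃) ∷ (x₄ ∨ y₄) ∷ []
        ps = (x₁ ∧ not y₁) ∷ (x₂ ∧ not y₂) ∷ (x₃ ∧ not y₃) ∷ (x₄ ∧ not y₄) ∷ []
        qs = (y₁ ∧ not x₁) ∷ (y₂ ∧ not x₂) ∷ (y₃ ∧ not x₃) ∷ (y₄ ∧ not x₄) ∷ []
    in parity xs ≡ true → parity ys ≡ true →
       (parity ms ≡ true × parity js ≡ true × (ms ≡ xs ⊎ ms ≡ ys)) ⊎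
       (parity ps ≡ true × parity qs ≡ true ×
         ((ps ≡ xs × qs ≡ ys) ⊎ (ps ≡ map not ys × qs ≡ map not xs)))
  odd-quadruples = toWitness {a? =
     ∀Bool? λ _ → ∀Bool? λ _ → ∀Bool? λ _ → ∀Bool? λ _ →
     ∀Bool? λ _ → ∀Bool? λ _ → ∀Bool? λ _ → ∀Bool? λ _ →
     (_ Bool.≟ _) →-dec (_ Bool.≟ _) →-dec
     (((_ Bool.≟ _) ×-dec (_ Bool.≟ _) ×-dec (≡-dec Bool._≟_ _ _ ⊎-dec ≡-dec Bool._≟_ _ _)) ⊎-dec
      ((_ Bool.≟ _) ×-dec (_ Bool.≟ _) ×-dec
        ((≡-dec Bool._≟_ _ _ ×-dec ≡-dec Bool._≟_ _ _) ⊎-dec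
         (≡-dec Bool._≟_ _ _ ×-dec ≡-dec Bool._≟_ _ _))))} _

module Terminals {n : ℕ} (a b c d : Fin n) where

  T : List (Fin n)
  T = a ∷ b ∷ c ∷ d ∷ []

  τ : VSet n → Bool
  τ χ = parity (map χ T)

  Connected : ℕ → List (Edge n) → Set
  Connected k L = ∀ χ → τ χ ≡ true → k ≤ size χ L

  -- For a multigraph this says that every vertex outside T has even degree.
  Balanced : List (Edge n) → Set
  Balanced L = ∀ χ ψ → map χ T ≡ map ψ T → odd (size χ L) ≡ odd (size ψ L)

  Connected-↭ : ∀ {k L M} → L ↭ M → Connected k L → Connected k M
  Connected-↭ L↭M conn χ τχ = ≤-trans (conn χ τχ) (≤-reflexive (size-↭ χ L↭M))

  Balanced-↭ : ∀ {L M} → L ↭ M → Balanced L → Balanced M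
  Balanced-↭ L↭M bal χ ψ eq =
    trans (cong odd (sym (size-↭ χ L↭M))) (trans (bal χ ψ eq) (cong odd (size-↭ ψ L↭M)))

  -- The number of terminals is even.
  τ-∁ : ∀ χ → τ (not ∘ χ) ≡ τ χ
  τ-∁ χ = table (χ a) (χ b) (χ c) (χ d)
    where
    table : ∀ w x y z → parity (map not (w ∷ x ∷ y ∷ z ∷ [])) ≡ parity (w ∷ x ∷ y ∷ z ∷ [])
    table = toWitness {a? = ∀Bool? λ _ → ∀Bool? λ _ → ∀Bool? λ _ → ∀Bool? λ _ → _ Bool.≟ _} _

  -- There are finitely many vertex sets. The search runs over Boolean vectors, and `Vec.tabulate`
  -- turns an arbitrary `χ` into one with the same cut.
  Connected? : ∀ k L → Connected k L ⊎ (∃[ χ ] τ χ ≡ true × size χ L < k)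
  Connected? k L
    with anySubset? (λ S → (τ (Vec.lookup S) Bool.≟ true) ×-dec (size (Vec.lookup S) L <? k))
  ... | yes (S , small) = inj₂ (Vec.lookup S , small)
  ... | no none = inj₁ λ χ τχ → ≮⇒≥ λ small → none
          ( Vec.tabulate χ
          , trans (cong parity (map-cong (lookup∘tabulate χ) T)) τχ
          , subst (_< k) (sym (size-cong (lookup∘tabulate χ) L)) small )

  -- Splitting off at a vertex outside T

  module Splitting {k : ℕ} {e : Edge n} {R : List (Edge n)} {y u : Fin n}
    (y∉T : y ∉ T) (u≢y : u ≢ y) (e-joins : Joins e y u)
    (conn : Connected k (e ∷ R)) (bal : Balanced (e ∷ R)) where

    L : List (Edge n)
    L = e ∷ R

    -- The T-odd cuts that splitting off e at y may bring below k, oriented away from y.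
    record Tight (χ : VSet n) : Set where
      field
        τ-odd : τ χ ≡ true
        y-out : χ y ≡ false
        u-in  : χ u ≡ true
        small : size χ L ≤ suc k
    open Tight

    e-cut : ∀ {χ p q} → χ y ≡ p → χ u ≡ q → cut χ e ≡ p xor q
    e-cut {χ} y≡ u≡ = trans (e-joins χ) (cong₂ _xor_ y≡ u≡)

    -- Equal traces on `T` force equal parity of the cuts, so a T-odd cut of at least `k` edges
    -- cannot be smaller than a tight one of at most `k + 1`.
    Tight-minimal : ∀ {χ ψ} → Tight χ → τ ψ ≡ true → map χ T ≡ map ψ T → size χ L ≤ size ψ L
    Tight-minimal {χ} {ψ} tχ τψ eq =
      ≤-of-≤suc-same-parity (small tχ) (conn ψ τψ) (bal χ ψ eq)

    Tight-minimal-∁ : ∀ {χ ψ} → Tight χ → τ ψ ≡ true → map ψ T ≡ map (not ∘ χ) T →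
                      size χ L ≤ size ψ L
    Tight-minimal-∁ {χ} {ψ} tχ τψ eq = ≤-of-≤suc-same-parity (small tχ) (conn ψ τψ)
      (trans (cong odd (sym (size-∁ χ L))) (bal (not ∘ χ) ψ (sym eq)))

    -- The edge `e` crosses both tight sets but neither difference, as `u` lies in both sets and `y`
    -- in neither. It therefore counts twice on the right and not at all on the left.
    ∖-strict : ∀ {χ ψ} → Tight χ → Tight ψ →
               size (χ ∖ ψ) L + size (ψ ∖ χ) L < size χ L + size ψ L
    ∖-strict {χ} {ψ} tχ tψ
      rewrite e-cut {χ} (y-out tχ) (u-in tχ) | e-cut {ψ} (y-out tψ) (u-in tψ)
            | e-cut {χ ∖ ψ} (cong (_∧ not (ψ y)) (y-out tχ))
                (cong₂ (λ p q → p ∧ not q) (u-in tχ) (u-in tψ))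
            | e-cut {ψ ∖ χ} (cong (_∧ not (χ y)) (y-out tψ))
                (cong₂ (λ p q → p ∧ not q) (u-in tψ) (u-in tχ))
      = s≤s (≤-trans (∖-submodular χ ψ R) (+-monoʳ-≤ (size χ R) (n≤1+n _)))

    -- If the intersection is T-odd, it has the trace of one of the two sets and is no smaller a cut
    -- than that one; submodularity then bounds the union by the other. If instead the differences
    -- are T-odd, their traces are those of the two sets or of their complements, so minimality
    -- contradicts `∖-strict`.
    Tight-∪ : ∀ {χ ψ} → Tight χ → Tight ψ → Tight (χ ∪ ψ)
    Tight-∪ {χ} {ψ} tχ tψ
      with odd-quadruples (χ a) (χ b) (χ c) (χ d) (ψ a) (ψ b) (ψ c) (ψ d) (τ-odd tχ) (τ-odd tψ)
    ... | inj₁ (τ∩ , τ∪ , ∩-trace) = record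
      { τ-odd = τ∪
      ; y-out = cong₂ _∨_ (y-out tχ) (y-out tψ)
      ; u-in  = cong (_∨ ψ u) (u-in tχ)
      ; small = ∪-small ∩-trace }
      where
      open ≤-Reasoning
      ∪-small : map (χ ∩ ψ) T ≡ map χ T ⊎ map (χ ∩ ψ) T ≡ map ψ T → size (χ ∪ ψ) L ≤ suc k
      ∪-small (inj₁ eq) = ≤-trans (+-cancelˡ-≤ (size χ L) _ _ (begin
        size χ L + size (χ ∪ ψ) L       ≤⟨ +-monoˡ-≤ _ (Tight-minimal tχ τ∩ (sym eq)) ⟩
        size (χ ∩ ψ) L + size (χ ∪ ψ) L ≤⟨ ∩-∪-submodular χ ψ L ⟩
        size χ L + size ψ L             ∎)) (small tψ)
      ∪-small (inj₂ eq) = ≤-trans (+-cancelˡ-≤ (size ψ L) _ _ (begin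
        size ψ L + size (χ ∪ ψ) L       ≤⟨ +-monoˡ-≤ _ (Tight-minimal tψ τ∩ (sym eq)) ⟩
        size (χ ∩ ψ) L + size (χ ∪ ψ) L ≤⟨ ∩-∪-submodular χ ψ L ⟩
        size χ L + size ψ L             ≡⟨ +-comm (size χ L) (size ψ L) ⟩
        size ψ L + size χ L             ∎)) (small tχ)
    ... | inj₂ (τp , τq , inj₁ (p≡ , q≡)) = contradiction
      (+-mono-≤ (Tight-minimal tχ τp (sym p≡)) (Tight-minimal tψ τq (sym q≡)))
      (<⇒≱ (∖-strict tχ tψ))
    ... | inj₂ (τp , τq , inj₂ (p≡ , q≡)) = contradiction
      (≤-trans (≤-reflexive (+-comm (size χ L) (size ψ L)))
        (+-mono-≤ (Tight-minimal-∁ tψ τp p≡) (Tight-minimal-∁ tχ τq q≡)))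
      (<⇒≱ (∖-strict tχ tψ))

    record Split : Set where
      field
        {f}       : Edge n
        {R′}      : List (Edge n)
        {w}       : Fin n
        R↭        : R ↭ f ∷ R′
        f-joins   : Joins f y w
        connected : Connected k ((u , w) ∷ R′)

    -- A T-odd cut that the merge brings below `k`, oriented away from `y`, must contain both `u`
    -- and `w`. The merge lowers such a cut by two, so it had at most `k + 1` edges before.
    Tight-or-split : ∀ {f w} → f ∈ R → Joins f y w → Split ⊎ (∃[ χ ] Tight χ × χ w ≡ true)
    Tight-or-split {f} {w} f∈R f-joins with R′ , R↭ ← ∈⇒↭ f∈R | Connected? k ((u , w) ∷ R′)
    ... | inj₁ connected = inj₁ record { R↭ = R↭ ; f-joins = f-joins ; connected = connected }
    ... | inj₂ (χ₀ , τχ₀ , few₀) = inj₂ (χ , tight , proj₂ u,w-in)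
      where
      -- Complementing moves `y` outside without changing the T-parity or the cut.
      normalise : ∃[ χ ] τ χ ≡ true × size χ ((u , w) ∷ R′) < k × χ y ≡ false
      normalise with χ₀ y in χ₀y
      ... | false = χ₀ , τχ₀ , few₀ , χ₀y
      ... | true  = not ∘ χ₀ , trans (τ-∁ χ₀) τχ₀
                  , subst (_< k) (sym (size-∁ χ₀ ((u , w) ∷ R′))) few₀ , cong not χ₀y
      χ   = proj₁ normalise
      τχ  = proj₁ (proj₂ normalise)
      few = proj₁ (proj₂ (proj₂ normalise))
      χy  = proj₂ (proj₂ (proj₂ normalise))
      size-L : size χ L ≡ bit (χ u) + (bit (χ w) + size χ R′)
      size-L = cong₂ _+_ (cong bit (e-cut {χ} χy refl))
        (trans (size-↭ χ R↭)
          (cong (λ z → bit z + size χ R′) (trans (f-joins χ) (cong (_xor χ w) χy))))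
      -- With `y` outside, the edges `yu` and `yw` cross no more often than `uw` would unless `u`
      -- and `w` are both inside.
      few⇒in : ∀ p q s → k ≤ bit p + (bit q + s) → bit (p xor q) + s < k → p ≡ true × q ≡ true
      few⇒in true  true  s k≤ <k = refl , refl
      few⇒in true  false s k≤ <k = contradiction k≤ (<⇒≱ <k)
      few⇒in false true  s k≤ <k = contradiction k≤ (<⇒≱ <k)
      few⇒in false false s k≤ <k = contradiction k≤ (<⇒≱ <k)
      u,w-in : χ u ≡ true × χ w ≡ true
      u,w-in = few⇒in (χ u) (χ w) (size χ R′) (≤-trans (conn χ τχ) (≤-reflexive size-L)) few
      tight : Tight χ
      tight = record
        { τ-odd = τχ ; y-out = χy ; u-in = proj₁ u,w-in
        ; small = begin
            size χ L
              ≡⟨ size-L ⟩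
            bit (χ u) + (bit (χ w) + size χ R′)
              ≡⟨ cong₂ (λ p q → bit p + (bit q + size χ R′)) (proj₁ u,w-in) (proj₂ u,w-in) ⟩
            suc (suc (size χ R′))
              ≡⟨ cong₂ (λ p q → suc (suc (bit (p xor q) + size χ R′)))
                   (proj₁ u,w-in) (proj₂ u,w-in) ⟨
            suc (suc (bit (χ u xor χ w) + size χ R′))
              ≤⟨ s≤s few ⟩
            suc k ∎ }
        where open ≤-Reasoning

    Off : Edge n → Set
    Off f = proj₁ f ≢ y × proj₂ f ≢ y

    -- The neighbour of `y` along `f` lies in `χ`; for edges not at `y` the condition is vacuous.
    Absorbs : VSet n → Edge n → Set
    Absorbs χ f = (proj₁ f ≡ y → χ (proj₂ f) ≡ true) × (proj₂ f ≡ y → χ (proj₁ f) ≡ true)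

    Absorbs-∪ˡ : ∀ {χ ψ f} → Absorbs χ f → Absorbs (χ ∪ ψ) f
    Absorbs-∪ˡ {ψ = ψ} {f} (l , r) =
      (λ eq → cong (_∨ ψ (proj₂ f)) (l eq)) , (λ eq → cong (_∨ ψ (proj₁ f)) (r eq))

    Absorbs-∪ʳ : ∀ {χ ψ f} → Absorbs ψ f → Absorbs (χ ∪ ψ) f
    Absorbs-∪ʳ {χ} {ψ} {f} (l , r) =
      (λ eq → trans (cong (χ (proj₂ f) ∨_) (l eq)) (Bool.∨-zeroʳ _)) ,
      (λ eq → trans (cong (χ (proj₁ f) ∨_) (r eq)) (Bool.∨-zeroʳ _))

    Off⇒Absorbs : ∀ {χ f} → Off f → Absorbs χ f
    Off⇒Absorbs (f₁≢y , f₂≢y) = (λ eq → contradiction eq f₁≢y) , (λ eq → contradiction eq f₂≢y)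

    absorb-or-split : ∀ {f} → f ∈ R → Split ⊎ Off f ⊎ (∃[ χ ] Tight χ × Absorbs χ f)
    absorb-or-split {s , t} f∈R with s ≟ y | t ≟ y
    ... | no s≢y | no t≢y = inj₂ (inj₁ (s≢y , t≢y))
    ... | yes refl | _ = case Tight-or-split f∈R (λ χ → refl) of λ where
      (inj₁ split)          → inj₁ split
      (inj₂ (χ , tχ , χt)) → inj₂ (inj₂ (χ , tχ , (λ _ → χt) , λ { refl → χt }))
    ... | no s≢y | yes refl = case Tight-or-split f∈R (λ χ → Bool.xor-comm (χ s) (χ y)) of λ where
      (inj₁ split)          → inj₁ split
      (inj₂ (χ , tχ , χs)) → inj₂ (inj₂ (χ , tχ , (λ eq → contradiction eq s≢y) , λ _ → χs))

    -- The tight sets found so far are merged by `Tight-∪`. The case that all edges are off `y` is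
    -- kept apart because the empty union is not tight.
    absorb-all-or-split : ∀ M → (∀ {f} → f ∈ M → f ∈ R) →
                          Split ⊎ All Off M ⊎ (∃[ χ ] Tight χ × All (Absorbs χ) M)
    absorb-all-or-split [] M⊆R = inj₂ (inj₁ [])
    absorb-all-or-split (f ∷ M) M⊆R
      with absorb-or-split (M⊆R (here refl)) | absorb-all-or-split M (M⊆R ∘ there)
    ... | inj₁ split | _ = inj₁ split
    ... | _ | inj₁ split = inj₁ split
    ... | inj₂ (inj₁ off) | inj₂ (inj₁ offs) = inj₂ (inj₁ (off ∷ offs))
    ... | inj₂ (inj₁ off) | inj₂ (inj₂ (ψ , tψ , hs)) =
      inj₂ (inj₂ (ψ , tψ , Off⇒Absorbs {ψ} off ∷ hs))
    ... | inj₂ (inj₂ (χ , tχ , h)) | inj₂ (inj₁ offs) =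
      inj₂ (inj₂ (χ , tχ , h ∷ All.map (Off⇒Absorbs {χ}) offs))
    ... | inj₂ (inj₂ (χ , tχ , h)) | inj₂ (inj₂ (ψ , tψ , hs)) =
      inj₂ (inj₂ (χ ∪ ψ , Tight-∪ tχ tψ , Absorbs-∪ˡ {χ} {ψ} h ∷ All.map (Absorbs-∪ʳ {χ} {ψ}) hs))

    trace-∪-y : ∀ χ → map (χ ∪ ind y) T ≡ map χ T
    trace-∪-y χ = map-cong-local (All.tabulate λ {t} t∈T →
      trans (cong (χ t ∨_) (ind-≢ (λ { refl → y∉T t∈T }))) (Bool.∨-identityʳ (χ t)))

    ∅ : VSet n
    ∅ _ = false

    -- Otherwise `e` would be the only edge at `y`. Balance is applied to `{y}` and the empty set,
    -- which have the same trace since `y` is no terminal.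
    not-all-Off : ¬ All Off R
    not-all-Off offs = case trans (sym odd-y) (trans (bal (∅ ∪ ind y) ∅ (trace-∪-y ∅)) even-∅) of λ ()
      where
      even-∅ : odd (size ∅ L) ≡ false
      even-∅ = cong odd (size-zero {χ = ∅} (All.universal (λ _ → refl) L))
      odd-y : odd (size (ind y) L) ≡ true
      odd-y = cong odd (cong₂ _+_ (cong bit (e-cut {ind y} (ind-≡ refl) (ind-≢ u≢y)))
        (size-zero {χ = ind y} (All.map (λ (s≢y , t≢y) → cong₂ _xor_ (ind-≢ s≢y) (ind-≢ t≢y)) offs)))

    -- Moving y into a tight set which contains all its neighbours shrinks the cut.
    not-all-absorbed : ∀ {χ} → Tight χ → ¬ All (Absorbs χ) R
    not-all-absorbed {χ} tχ hs = contradiction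
      (Tight-minimal tχ (trans (cong parity (trace-∪-y χ)) (τ-odd tχ)) (sym (trace-∪-y χ)))
      (<⇒≱ smaller)
      where
      ψ = χ ∪ ind y
      ψy : ψ y ≡ true
      ψy = trans (cong (χ y ∨_) (ind-≡ refl)) (Bool.∨-zeroʳ (χ y))
      ψ-out : ∀ {v} → v ≢ y → ψ v ≡ χ v
      ψ-out {v} v≢y = trans (cong (χ v ∨_) (ind-≢ v≢y)) (Bool.∨-identityʳ (χ v))
      ψ-in : ∀ {v} → χ v ≡ true → ψ v ≡ true
      ψ-in {v} χv = cong (_∨ ind y v) χv
      shrink : ∀ {f} → Absorbs χ f → cut ψ f ≡ true → cut χ f ≡ true
      shrink {s , t} (l , r) cut-ψ = by-ends (s ≟ y) (t ≟ y)
        where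
        by-ends : Dec (s ≡ y) → Dec (t ≡ y) → χ s xor χ t ≡ true
        by-ends (no s≢y) (no t≢y) = trans (sym (cong₂ _xor_ (ψ-out s≢y) (ψ-out t≢y))) cut-ψ
        by-ends (yes refl) _ = case trans (sym cut-ψ) (cong₂ _xor_ ψy (ψ-in (l refl))) of λ ()
        by-ends (no _) (yes refl) = case trans (sym cut-ψ) (cong₂ _xor_ (ψ-in (r refl)) ψy) of λ ()
      -- The drop is strict because `e` crosses `χ` but no longer `ψ`.
      smaller : size ψ L < size χ L
      smaller rewrite e-cut {χ} (y-out tχ) (u-in tχ) | e-cut {ψ} ψy (ψ-in (u-in tχ)) =
        s≤s (size-mono {χ = ψ} {χ} (All.map shrink hs))

    split : Split
    split with absorb-all-or-split R (λ f∈R → f∈R)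
    ... | inj₁ s = s
    ... | inj₂ (inj₁ offs) = contradiction offs not-all-Off
    ... | inj₂ (inj₂ (χ , tχ , hs)) = contradiction hs (not-all-absorbed tχ)

  -- Edges between terminals

  -- A relabelling of the terminals, so that each argument is given for one labelling and reused for
  -- the symmetric ones.
  Frame : (w x y z : Fin n) → Set
  Frame w x y z = T ↭ w ∷ x ∷ y ∷ z ∷ []

  Link : Fin n → Fin n → Edge n → Set
  Link x z e = e ≡ (x , z) ⊎ e ≡ (z , x)

  Link? : ∀ x z → Decidable (Link x z)
  Link? x z e = ×-≡-dec _≟_ _≟_ e (x , z) ⊎-dec ×-≡-dec _≟_ _≟_ e (z , x)

  Link⇒Joins : ∀ {x z e} → Link x z e → Joins e x z
  Link⇒Joins (inj₁ refl) χ = refl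
  Link⇒Joins (inj₂ refl) χ = Bool.xor-comm (χ _) (χ _)

  Link-swap : ∀ {x z e} → Link x z e → Link z x e
  Link-swap (inj₁ eq) = inj₂ eq
  Link-swap (inj₂ eq) = inj₁ eq

  No : Fin n → Fin n → List (Edge n) → Set
  No x z = All (¬_ ∘ Link x z)

  No-swap : ∀ {x z L} → No x z L → No z x L
  No-swap = All.map (_∘ Link-swap)

  Inner : Edge n → Set
  Inner e = proj₁ e ≡ proj₂ e ⊎ (proj₁ e ∈ T × proj₂ e ∈ T)

  -- `Q` is a T-join, described by its parity on every cut. It becomes one chain of the packing and
  -- costs the rest one unit of connectivity.
  record Peeled (k : ℕ) (L : List (Edge n)) : Set where
    field
      {Q M}     : List (Edge n)
      L↭        : L ↭ Q ++ M
      join      : ∀ χ → odd (size χ Q) ≡ τ χ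
      connected : Connected k M

  module Framed (T-unique : Unique T) {w x y z : Fin n} (F : Frame w x y z) where

    τ-frame : ∀ χ → τ χ ≡ parity (χ w ∷ χ x ∷ χ y ∷ χ z ∷ [])
    τ-frame χ = ↭ₛ.foldr-commMonoid (setoid Bool)
      (CommutativeRing.+-isCommutativeMonoid Bool.xor-∧-commutativeRing) (↭⇒↭ₛ (map⁺ χ F))

    frame-unique : Unique (w ∷ x ∷ y ∷ z ∷ [])
    frame-unique = ↭ₛ.Unique-resp-↭ (setoid (Fin n)) (↭⇒↭ₛ F) T-unique

    x≢w : x ≢ w
    x≢w with (w≢x ∷ _) ∷ _ ← frame-unique = w≢x ∘ sym

    y≢w : y ≢ w
    y≢w with (_ ∷ w≢y ∷ _) ∷ _ ← frame-unique = w≢y ∘ sym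

    z≢w : z ≢ w
    z≢w with (_ ∷ _ ∷ w≢z ∷ _) ∷ _ ← frame-unique = w≢z ∘ sym

    τ-ind : τ (ind w) ≡ true
    τ-ind = trans (τ-frame (ind w)) (cong parity
      (cong₂ _∷_ (ind-≡ {v = w} refl) (cong₂ _∷_ (ind-≢ x≢w)
      (cong₂ _∷_ (ind-≢ y≢w) (cong (_∷ []) (ind-≢ z≢w))))))

    other-terminal : ∀ {v} → v ∈ T → v ≢ w → v ≡ x ⊎ v ≡ y ⊎ v ≡ z
    other-terminal v∈T v≢w with ∈-resp-↭ F v∈T
    ... | here v≡w = contradiction v≡w v≢w
    ... | there (here v≡x) = inj₁ v≡x
    ... | there (there (here v≡y)) = inj₂ (inj₁ v≡y)
    ... | there (there (there (here v≡z))) = inj₂ (inj₂ v≡z)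

    crossing-link : ∀ {e} → Inner e → cut (ind w) e ≡ true → Link w x e ⊎ Link w y e ⊎ Link w z e
    crossing-link {s , t} (inj₁ refl) crosses =
      case trans (sym crosses) (Bool.xor-same (ind w s)) of λ ()
    crossing-link {s , t} (inj₂ (s∈T , t∈T)) crosses = by-ends (s ≟ w) (t ≟ w)
      where
      by-ends : Dec (s ≡ w) → Dec (t ≡ w) →
                Link w x (s , t) ⊎ Link w y (s , t) ⊎ Link w z (s , t)
      by-ends (yes refl) (yes refl) = case trans (sym crosses) (Bool.xor-same (ind w w)) of λ ()
      by-ends (no s≢w) (no t≢w) =
        case trans (sym crosses) (cong₂ _xor_ (ind-≢ s≢w) (ind-≢ t≢w)) of λ ()
      by-ends (yes refl) (no t≢w) with other-terminal t∈T t≢w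
      ... | inj₁ refl        = inj₁ (inj₁ refl)
      ... | inj₂ (inj₁ refl) = inj₂ (inj₁ (inj₁ refl))
      ... | inj₂ (inj₂ refl) = inj₂ (inj₂ (inj₁ refl))
      by-ends (no s≢w) (yes refl) with other-terminal s∈T s≢w
      ... | inj₁ refl        = inj₁ (inj₂ refl)
      ... | inj₂ (inj₁ refl) = inj₂ (inj₁ (inj₂ refl))
      ... | inj₂ (inj₂ refl) = inj₂ (inj₂ (inj₂ refl))

    forced-link : ∀ {L} → All Inner L → No w y L → No w z L →
                  ∀ {e} → e ∈ L → cut (ind w) e ≡ true → Link w x e
    forced-link inner no-wy no-wz e∈L crosses with crossing-link (All.lookup inner e∈L) crosses
    ... | inj₁ wx        = wx
    ... | inj₂ (inj₁ wy) = contradiction wy (All.lookup no-wy e∈L)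
    ... | inj₂ (inj₂ wz) = contradiction wz (All.lookup no-wz e∈L)

    extract-link : ∀ {L} → All Inner L → No w y L → No w z L → 1 ≤ size (ind w) L →
                   ∃[ e ] ∃[ M ] Link w x e × L ↭ e ∷ M
    extract-link {L} inner no-wy no-wz 1≤ with e , e∈L , crosses ← crossed-edge (ind w) L 1≤
      with M , L↭ ← ∈⇒↭ e∈L = e , M , forced-link inner no-wy no-wz e∈L crosses , L↭

    -- The set `{w}` is T-odd, so some edge leaves `w`.
    not-isolated : ∀ {k L} → Connected (suc k) L → All Inner L → No w x L → No w y L → ¬ No w z L
    not-isolated {k} {L} conn inner no-wx no-wy no-wz
      with e , e∈L , crosses ← crossed-edge (ind w) L (≤-trans (s≤s z≤n) (conn (ind w) τ-ind)) =
      All.lookup no-wx e∈L (forced-link inner no-wy no-wz e∈L crosses)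

    -- A T-odd set has one terminal alone on one side, so it separates exactly one pair of a perfect
    -- matching. Removing the matching lowers every T-odd cut by exactly one.
    matching : ∀ {k L} → Connected (suc k) L → Peeled k L ⊎ No w x L ⊎ No y z L
    matching {k} {L} conn with extract (Link? w x) L
    ... | inj₂ no-wx = inj₂ (inj₁ no-wx)
    ... | inj₁ (e , L₁ , wx , L↭) with extract (Link? y z) L₁
    -- The edge `e` set aside joins `w` and `x`, so it is not a missed link between `y` and `z`.
    ...   | inj₂ no-yz = inj₂ (inj₂ (All-resp-↭ (↭-sym L↭) (e-avoids wx ∷ no-yz)))
      where
      e-avoids : ∀ {e} → Link w x e → ¬ Link y z e
      e-avoids (inj₁ refl) (inj₁ refl) = y≢w refl
      e-avoids (inj₁ refl) (inj₂ refl) = z≢w refl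
      e-avoids (inj₂ refl) (inj₁ refl) = z≢w refl
      e-avoids (inj₂ refl) (inj₂ refl) = y≢w refl
    ...   | inj₁ (f , M , yz , L₁↭) = inj₁ record
      { Q = e ∷ f ∷ [] ; M = M ; L↭ = L↭ef ; join = join ; connected = connected }
      where
      L↭ef : L ↭ e ∷ f ∷ M
      L↭ef = ↭-trans L↭ (↭-prep e L₁↭)
      join : ∀ χ → odd (size χ (e ∷ f ∷ [])) ≡ τ χ
      join χ rewrite Link⇒Joins wx χ | Link⇒Joins yz χ | τ-frame χ =
        table (χ w) (χ x) (χ y) (χ z)
        where
        table : ∀ w x y z →
                odd (bit (w xor x) + (bit (y xor z) + 0)) ≡ parity (w ∷ x ∷ y ∷ z ∷ [])
        table = toWitness {a? = ∀Bool? λ _ → ∀Bool? λ _ → ∀Bool? λ _ → ∀Bool? λ _ → _ Bool.≟ _} _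
      connected : Connected k M
      connected χ τχ = s≤s⁻¹ (≤-trans (conn χ τχ) (≤-reflexive (begin
        size χ L
          ≡⟨ size-↭ χ L↭ef ⟩
        bit (cut χ e) + (bit (cut χ f) + size χ M)
          ≡⟨ +-assoc (bit (cut χ e)) _ _ ⟨
        bit (cut χ e) + bit (cut χ f) + size χ M
          ≡⟨ cong₂ (λ p q → bit p + bit q + size χ M) (Link⇒Joins wx χ) (Link⇒Joins yz χ) ⟩
        bit (χ w xor χ x) + bit (χ y xor χ z) + size χ M
          ≡⟨ cong (_+ size χ M) (table (χ w) (χ x) (χ y) (χ z) (trans (sym (τ-frame χ)) τχ)) ⟩
        suc (size χ M) ∎)))
        where
        open ≡-Reasoning
        table : ∀ w x y z → parity (w ∷ x ∷ y ∷ z ∷ []) ≡ true →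
                bit (w xor x) + bit (y xor z) ≡ 1
        table = toWitness {a? = ∀Bool? λ _ → ∀Bool? λ _ → ∀Bool? λ _ → ∀Bool? λ _ →
                                (_ Bool.≟ _) →-dec (_ ≟ℕ _)} _

  -- Peeling a matching or a star off the edges between terminals.

  module Base (T-unique : Unique T) where

    open Framed T-unique

    spokes-join : ∀ p q r s → parity (p ∷ q ∷ r ∷ s ∷ []) ≡
                  odd (bit (q xor p) + (bit (r xor p) + (bit (s xor p) + 0)))
    spokes-join = toWitness {a? = ∀Bool? λ _ → ∀Bool? λ _ → ∀Bool? λ _ → ∀Bool? λ _ → _ Bool.≟ _} _

    -- Here `p` is the hub. A T-odd set isolates one terminal: a leaf, and one spoke is crossed, or
    -- the hub, which is then separated from the leaf `q`.
    spokes-cut : ∀ p q r s → parity (p ∷ q ∷ r ∷ s ∷ []) ≡ true →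
                 bit (q xor p) + bit (r xor p) + bit (s xor p) ≡ 1 ⊎ q xor p ≡ true
    spokes-cut = toWitness {a? = ∀Bool? λ _ → ∀Bool? λ _ → ∀Bool? λ _ → ∀Bool? λ _ →
                                 (_ Bool.≟ _) →-dec ((_ ≟ℕ _) ⊎-dec (_ Bool.≟ _))} _

    frame-x : ∀ {w x y z} → Frame w x y z → Frame x w y z
    frame-x F = ↭-trans F (↭-swap _ _ ↭-refl)

    frame-y : ∀ {w x y z} → Frame w x y z → Frame y w x z
    frame-y {w} {x} {y} {z} F = ↭-trans F (shift y (w ∷ x ∷ []) (z ∷ []))

    frame-z : ∀ {w x y z} → Frame w x y z → Frame z w x y
    frame-z {w} {x} {y} {z} F = ↭-trans F (shift z (w ∷ x ∷ y ∷ []) [])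

    uncrossed : ∀ {e p q} v → Link p q e → p ≢ v → q ≢ v → cut (ind v) e ≡ false
    uncrossed v pq p≢v q≢v =
      trans (Link⇒Joins pq (ind v)) (cong₂ _xor_ (ind-≢ p≢v) (ind-≢ q≢v))

    -- A cut crossing one spoke loses only one edge. A cut isolating the hub loses three, but it
    -- keeps all remaining edges at the leaf `x`, since these all run to `w`, and there are at least
    -- `k` of them.
    peel-spokes : ∀ {k L w x y z e f g M} → Frame w x y z → Connected (suc k) L →
                  L ↭ e ∷ f ∷ g ∷ M → Link x w e → Link y w f → Link z w g →
                  All Inner M → No x y M → No x z M → Peeled k L
    peel-spokes {k} {L} {w} {x} {y} {z} {e} {f} {g} {M} F conn L↭ xw yw zw inner no-xy no-xz =
      record { Q = e ∷ f ∷ g ∷ [] ; M = M ; L↭ = L↭ ; join = join ; connected = connected }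
      where
      Fx = frame-x F
      join : ∀ χ → odd (size χ (e ∷ f ∷ g ∷ [])) ≡ τ χ
      join χ rewrite Link⇒Joins xw χ | Link⇒Joins yw χ | Link⇒Joins zw χ | τ-frame F χ =
        sym (spokes-join (χ w) (χ x) (χ y) (χ z))
      size-L : ∀ χ → size χ L ≡ bit (cut χ e) + bit (cut χ f) + bit (cut χ g) + size χ M
      size-L χ = begin
        size χ L                              ≡⟨ size-↭ χ L↭ ⟩
        bit (cut χ e) + (bit (cut χ f) + (bit (cut χ g) + size χ M))
          ≡⟨ +-assoc (bit (cut χ e)) _ _ ⟨
        bit (cut χ e) + bit (cut χ f) + (bit (cut χ g) + size χ M)
          ≡⟨ +-assoc (bit (cut χ e) + bit (cut χ f)) _ _ ⟨
        bit (cut χ e) + bit (cut χ f) + bit (cut χ g) + size χ M ∎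
        where open ≡-Reasoning
      -- Only the spoke `e` can meet `x`, so the cut around `x` loses at most one of its `k + 1` or
      -- more edges.
      leaf : k ≤ size (ind x) M
      leaf = s≤s⁻¹ (≤-trans (conn (ind x) (τ-ind Fx)) (≤-trans (≤-reflexive (size-L (ind x)))
        (+-monoˡ-≤ (size (ind x) M) (begin
          bit (cut (ind x) e) + bit (cut (ind x) f) + bit (cut (ind x) g)
            ≡⟨ cong₂ (λ p q → bit (cut (ind x) e) + bit p + bit q)
                 (uncrossed x yw (y≢w Fx) (x≢w Fx))
                 (uncrossed x zw (z≢w Fx) (x≢w Fx)) ⟩
          bit (cut (ind x) e) + 0 + 0 ≤⟨ bit≤1 (cut (ind x) e) ⟩
          1 ∎))))
        where
        open ≤-Reasoning
        bit≤1 : ∀ p → bit p + 0 + 0 ≤ 1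
        bit≤1 true  = ≤-refl
        bit≤1 false = z≤n
      connected : Connected k M
      connected χ τχ with spokes-cut (χ w) (χ x) (χ y) (χ z) (trans (sym (τ-frame F χ)) τχ)
      ... | inj₁ one = s≤s⁻¹ (≤-trans (conn χ τχ) (≤-reflexive (trans (size-L χ)
              (cong (_+ size χ M) (trans bits one)))))
        where
        bits : bit (cut χ e) + bit (cut χ f) + bit (cut χ g) ≡
               bit (χ x xor χ w) + bit (χ y xor χ w) + bit (χ z xor χ w)
        bits rewrite Link⇒Joins xw χ | Link⇒Joins yw χ | Link⇒Joins zw χ = refl
      ... | inj₂ crosses = ≤-trans leaf (size-mono {χ = ind x} {χ} (All.tabulate λ h∈M crosses-x →
              trans (Link⇒Joins (forced-link Fx inner no-xy no-xz h∈M crosses-x) χ) crosses))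

    positive : ∀ {k L w x y z} → Connected (suc k) L → Frame w x y z → 1 ≤ size (ind w) L
    positive conn F = ≤-trans (s≤s z≤n) (conn (ind _) (τ-ind F))

    -- Each leaf has an edge, and it can only run to the hub `w`. The spokes are taken in turn;
    -- those already taken miss the next leaf, so its cut is still nonempty.
    star : ∀ {k L w x y z} → Frame w x y z → Connected (suc k) L → All Inner L →
           No x y L → No x z L → No y z L → Peeled k L
    star {k} {L} {w} {x} {y} {z} F conn inner no-xy no-xz no-yz
      with e , L₁ , xw , L↭ ← extract-link (frame-x F) inner no-xy no-xz
             (positive {L = L} conn (frame-x F))
      with _ ∷ inner₁ ← All-resp-↭ L↭ inner
         | _ ∷ no-xy₁ ← All-resp-↭ L↭ no-xy
         | _ ∷ no-xz₁ ← All-resp-↭ L↭ no-xz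
         | _ ∷ no-yz₁ ← All-resp-↭ L↭ no-yz
         | y∉e ← uncrossed y xw (y≢w (frame-y F)) (x≢w (frame-y F))
      with f , L₂ , yw , L₁↭ ← extract-link (frame-y F) inner₁ (No-swap no-xy₁) no-yz₁
             (subst (1 ≤_) (size-tail (ind y) L↭ y∉e) (positive {L = L} conn (frame-y F)))
      with _ ∷ inner₂ ← All-resp-↭ L₁↭ inner₁
         | _ ∷ no-xy₂ ← All-resp-↭ L₁↭ no-xy₁
         | _ ∷ no-xz₂ ← All-resp-↭ L₁↭ no-xz₁
         | _ ∷ no-yz₂ ← All-resp-↭ L₁↭ no-yz₁
         | z∉e ← uncrossed z xw (y≢w (frame-z F)) (x≢w (frame-z F))
         | z∉f ← uncrossed z yw (z≢w (frame-z F)) (x≢w (frame-z F))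
      with g , M , zw , L₂↭ ← extract-link (frame-z F) inner₂ (No-swap no-xz₂) (No-swap no-yz₂)
             (subst (1 ≤_) (trans (size-tail (ind z) L↭ z∉e) (size-tail (ind z) L₁↭ z∉f))
               (positive {L = L} conn (frame-z F)))
      with _ ∷ inner₃ ← All-resp-↭ L₂↭ inner₂
         | _ ∷ no-xy₃ ← All-resp-↭ L₂↭ no-xy₂
         | _ ∷ no-xz₃ ← All-resp-↭ L₂↭ no-xz₂
      = peel-spokes F conn (↭-trans L↭ (↭-prep e (↭-trans L₁↭ (↭-prep f L₂↭)))) xw yw zw
                    inner₃ no-xy₃ no-xz₃

    -- If no perfect matching exists, each of the three lacks one of its links. Of the eight
    -- choices, four isolate a terminal, which is impossible, and four miss a triangle, which leaves
    -- a star at the fourth terminal.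
    peel : ∀ {k L} → Connected (suc k) L → All Inner L → Peeled k L
    peel {k} {L} conn inner 
      with matching ↭-refl conn
         | matching (↭-prep a (↭-swap b c ↭-refl)) conn
         | matching (↭-prep a (shift d (b ∷ c ∷ []) [])) conn
    ... | inj₁ p | _ | _ = p
    ... | _ | inj₁ p | _ = p
    ... | _ | _ | inj₁ p = p
    ... | inj₂ (inj₁ ab) | inj₂ (inj₁ ac) | inj₂ (inj₁ ad) =
      contradiction ad (not-isolated ↭-refl conn inner ab ac)
    ... | inj₂ (inj₁ ab) | inj₂ (inj₂ bd) | inj₂ (inj₂ bc) =
      contradiction bd (not-isolated (frame-x ↭-refl) conn inner (No-swap ab) bc)
    ... | inj₂ (inj₂ cd) | inj₂ (inj₁ ac) | inj₂ (inj₂ bc) =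
      contradiction cd (not-isolated (frame-y ↭-refl) conn inner (No-swap ac) (No-swap bc))
    ... | inj₂ (inj₂ cd) | inj₂ (inj₂ bd) | inj₂ (inj₁ ad) =
      contradiction (No-swap cd) (not-isolated (frame-z ↭-refl) conn inner (No-swap ad) (No-swap bd))
    ... | inj₂ (inj₂ cd) | inj₂ (inj₂ bd) | inj₂ (inj₂ bc) = star ↭-refl conn inner bc bd cd
    ... | inj₂ (inj₂ cd) | inj₂ (inj₁ ac) | inj₂ (inj₁ ad) =
      star (frame-x ↭-refl) conn inner ac ad cd
    ... | inj₂ (inj₁ ab) | inj₂ (inj₂ bd) | inj₂ (inj₁ ad) =
      star (frame-y ↭-refl) conn inner ab ad bd
    ... | inj₂ (inj₁ ab) | inj₂ (inj₁ ac) | inj₂ (inj₂ bc) =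
      star (frame-z ↭-refl) conn inner ab ac bc

  -- Packings as edge colourings.

  -- Colours k, k + 1, … mark unused edges.
  load : ℕ → VSet n → List (ℕ × Edge n) → ℕ
  load i χ C = sum (map (λ ce → bit ((proj₁ ce ≡ᵇ i) ∧ cut χ (proj₂ ce))) C)

  -- Every colour below `k` forms a T-join; one colour per edge makes these joins disjoint.
  Packs : ℕ → List (ℕ × Edge n) → Set
  Packs k C = ∀ i χ → i < k → odd (load i χ C) ≡ τ χ

  Packable : ℕ → List (Edge n) → Set
  Packable k L = ∃[ C ] map proj₂ C ≡ L × Packs k C

  Packable-↭ : ∀ {k L M} → L ↭ M → Packable k L → Packable k M
  Packable-↭ L↭M (C , refl , packs) with C′ , eq , C↭C′ ← ↭-map-inv proj₂ L↭M =
    C′ , sym eq , λ i χ i<k → trans (cong odd (sym (sum-↭ (map⁺ _ C↭C′)))) (packs i χ i<k)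

  -- A chain through the edge replacing e and f uses both of them.
  odd-merge : ∀ m y u w l → odd (bit (m ∧ (y xor u)) + (bit (m ∧ (y xor w)) + l)) ≡
                            odd (bit (m ∧ (u xor w)) + l)
  odd-merge m y u w l = begin
    odd (bit (m ∧ (y xor u)) + (bit (m ∧ (y xor w)) + l))
      ≡⟨ cong odd (+-assoc (bit (m ∧ (y xor u))) _ l) ⟨
    odd (bit (m ∧ (y xor u)) + bit (m ∧ (y xor w)) + l)
      ≡⟨ odd-+ (bit (m ∧ (y xor u)) + bit (m ∧ (y xor w))) l ⟩
    odd (bit (m ∧ (y xor u)) + bit (m ∧ (y xor w))) xor odd l
      ≡⟨ cong (_xor odd l) (table m y u w) ⟩
    odd (bit (m ∧ (u xor w))) xor odd l
      ≡⟨ odd-+ (bit (m ∧ (u xor w))) l ⟨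
    odd (bit (m ∧ (u xor w)) + l) ∎
    where
    open ≡-Reasoning
    table : ∀ m y u w → odd (bit (m ∧ (y xor u)) + bit (m ∧ (y xor w))) ≡ odd (bit (m ∧ (u xor w)))
    table = toWitness {a? = ∀Bool? λ _ → ∀Bool? λ _ → ∀Bool? λ _ → ∀Bool? λ _ → _ Bool.≟ _} _

  Balanced-split : ∀ {e f R y u w} → Joins e y u → Joins f y w →
                   Balanced (e ∷ f ∷ R) → Balanced ((u , w) ∷ R)
  Balanced-split {e} {f} {R} {y} {u} {w} e-joins f-joins bal χ ψ eq =
    trans (sym (merged χ)) (trans (bal χ ψ eq) (merged ψ))
    where
    merged : ∀ χ → odd (size χ (e ∷ f ∷ R)) ≡ odd (size χ ((u , w) ∷ R))
    merged χ rewrite e-joins χ | f-joins χ = odd-merge true (χ y) (χ u) (χ w) (size χ R)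

  -- Both `e` and `f` inherit the colour `m` of the merged edge.
  Packable-split : ∀ {k e f R y u w} → Joins e y u → Joins f y w →
                   Packable k ((u , w) ∷ R) → Packable k (e ∷ f ∷ R)
  Packable-split {k} {e} {f} {y = y} {u} {w} e-joins f-joins ((m , _) ∷ C , refl , packs) =
    (m , e) ∷ (m , f) ∷ C , refl , λ i χ i<k → trans (merged i χ) (packs i χ i<k)
    where
    merged : ∀ i χ → odd (load i χ ((m , e) ∷ (m , f) ∷ C)) ≡ odd (load i χ ((m , (u , w)) ∷ C))
    merged i χ rewrite e-joins χ | f-joins χ =
      odd-merge (m ≡ᵇ i) (χ y) (χ u) (χ w) (load i χ C)

  add-colour : List (Edge n) → List (ℕ × Edge n) → List (ℕ × Edge n)
  add-colour Q C = map (0 ,_) Q ++ map (map₁ suc) C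

  load-shift : ∀ i χ C Q →
               load (suc i) χ (add-colour Q C) ≡ load i χ C
  load-shift i χ [] [] = refl
  load-shift i χ ((m , e) ∷ C) [] = cong (bit ((m ≡ᵇ i) ∧ cut χ e) +_) (load-shift i χ C [])
  load-shift i χ C (e ∷ Q) = load-shift i χ C Q

  load-zero : ∀ χ C Q → load 0 χ (add-colour Q C) ≡ size χ Q
  load-zero χ [] [] = refl
  load-zero χ (_ ∷ C) [] = load-zero χ C []
  load-zero χ C (e ∷ Q) = cong (bit (cut χ e) +_) (load-zero χ C Q)

  forget-shift : ∀ (C : List (ℕ × Edge n)) Q →
                 map proj₂ (add-colour Q C) ≡ Q ++ map proj₂ C
  forget-shift [] [] = refl
  forget-shift ((m , e) ∷ C) [] = cong (e ∷_) (forget-shift C [])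
  forget-shift C (e ∷ Q) = cong (e ∷_) (forget-shift C Q)

  -- The packing, by induction.

  module Pack (T-unique : Unique T) where

    open Base T-unique using (peel)
    open DecMembership {A = Fin n} _≟_ using (_∈?_)

    pack-inner : ∀ k {L} → Connected k L → All Inner L → Packable k L
    pack-inner zero {L} conn inner =
      map (0 ,_) L , trans (sym (map-∘ L)) (map-id L) , λ _ _ ()
    pack-inner (suc k) {L} conn inner
      with record { Q = Q ; L↭ = L↭ ; join = join ; connected = conn′ } ← peel conn inner
      with C , refl , packs ← pack-inner k conn′ (All.++⁻ʳ Q (All-resp-↭ L↭ inner)) =
      Packable-↭ (↭-sym L↭)
        ( add-colour Q C
        , forget-shift C Q
        , λ { zero    χ _         → trans (cong odd (load-zero χ C Q)) (join χ)
            ; (suc i) χ (s≤s i<k) → trans (cong odd (load-shift i χ C Q)) (packs i χ i<k) } )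

    Splittable : Edge n → Set
    Splittable e = proj₁ e ≢ proj₂ e × (proj₁ e ∉ T ⊎ proj₂ e ∉ T)

    Splittable? : Decidable Splittable
    Splittable? (s , t) = ¬? (s ≟ t) ×-dec (¬? (s ∈? T) ⊎-dec ¬? (t ∈? T))

    ¬Splittable⇒Inner : ∀ {e} → ¬ Splittable e → Inner e
    ¬Splittable⇒Inner {s , t} ¬split with s ≟ t | s ∈? T | t ∈? T
    ... | yes s≡t | _ | _ = inj₁ s≡t
    ... | no s≢t | no s∉T | _ = contradiction (s≢t , inj₁ s∉T) ¬split
    ... | no s≢t | yes _ | no t∉T = contradiction (s≢t , inj₂ t∉T) ¬split
    ... | no _ | yes s∈T | yes t∈T = inj₂ (s∈T , t∈T)

    outer-end : ∀ {e} → Splittable e → ∃[ y ] ∃[ u ] y ∉ T × u ≢ y × Joins e y u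
    outer-end {s , t} (s≢t , inj₁ s∉T) = s , t , s∉T , s≢t ∘ sym , λ χ → refl
    outer-end {s , t} (s≢t , inj₂ t∉T) = t , s , t∉T , s≢t , λ χ → Bool.xor-comm (χ s) (χ t)

    -- The bound `m` on the number of edges drives the recursion, as each split replaces two edges
    -- by one.
    pack : ∀ m k {L} → length L ≤ m → Connected k L → Balanced L → Packable k L
    pack m k {L} len conn bal with extract Splittable? L
    ... | inj₂ none = pack-inner k conn (All.map ¬Splittable⇒Inner none)
    pack zero k len conn bal | inj₁ (e , R , _ , L↭) =
      contradiction (≤-trans (≤-reflexive (sym (↭-length L↭))) len) λ ()
    pack (suc m) k {L} len conn bal | inj₁ (e , R , e-split , L↭)
      with y , u , y∉T , u≢y , e-joins ← outer-end e-split
      with record { f = f ; R′ = R′ ; w = w ; R↭ = R↭ ; f-joins = f-joins ; connected = conn′ }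
             ← Splitting.split y∉T u≢y e-joins (Connected-↭ {k} L↭ conn) (Balanced-↭ L↭ bal) =
      Packable-↭ (↭-sym L↭ef) (Packable-split e-joins f-joins
        (pack m k (s≤s⁻¹ (≤-trans (≤-reflexive (sym (↭-length L↭ef))) len)) conn′
          (Balanced-split {R = R′} e-joins f-joins (Balanced-↭ L↭ef bal))))
      where
      L↭ef : L ↭ e ∷ f ∷ R′
      L↭ef = ↭-trans L↭ (↭-prep e R↭)

-- Chains and boundaries

xorSum-cong : ∀ {m} {f g : A m} → f ≗ g → xorSum f ≡ xorSum g
xorSum-cong {zero}  f≗g = refl
xorSum-cong {suc m} f≗g = cong₂ _xor_ (f≗g zero) (xorSum-cong (f≗g ∘ suc))

xorSum-false : ∀ m → xorSum {m} (λ _ → false) ≡ false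
xorSum-false zero    = refl
xorSum-false (suc m) = xorSum-false m

xorSum-⊕ : ∀ {m} (f g : A m) → xorSum (f ⊕ g) ≡ xorSum f xor xorSum g
xorSum-⊕ {zero}  f g = refl
xorSum-⊕ {suc m} f g = trans
  (cong ((f zero xor g zero) xor_) (xorSum-⊕ (f ∘ suc) (g ∘ suc)))
  (interchange (f zero) (g zero) _ _)
  where
  open import Algebra.Properties.CommutativeSemigroup
    (CommutativeRing.+-commutativeSemigroup Bool.xor-∧-commutativeRing) using (interchange)

∧-xorSum : ∀ {m} p (f : A m) → p ∧ xorSum f ≡ xorSum (λ v → p ∧ f v)
∧-xorSum {m} false f = sym (xorSum-false m)
∧-xorSum     true  f = refl

xorSum-swap : ∀ {l m} (f : Fin l → A m) →
              xorSum (λ i → xorSum (f i)) ≡ xorSum (λ j → xorSum (λ i → f i j))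
xorSum-swap {zero}  {m} f = sym (xorSum-false m)
xorSum-swap {suc l} f = trans (cong (xorSum (f zero) xor_) (xorSum-swap (f ∘ suc)))
  (sym (xorSum-⊕ (f zero) (λ j → xorSum (λ i → f (suc i) j))))

xorSum-δ : ∀ {m} (χ : A m) s → xorSum (λ v → χ v ∧ δ s v) ≡ χ s
xorSum-δ {suc m} χ zero = begin
  (χ zero ∧ true) xor xorSum (λ v → χ (suc v) ∧ false)
    ≡⟨ cong₂ _xor_ (Bool.∧-identityʳ (χ zero))
         (trans (xorSum-cong (λ v → Bool.∧-zeroʳ (χ (suc v)))) (xorSum-false m)) ⟩
  χ zero xor false ≡⟨ Bool.xor-identityʳ (χ zero) ⟩
  χ zero ∎
  where open ≡-Reasoning
xorSum-δ {suc m} χ (suc s) = begin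
  (χ zero ∧ false) xor xorSum (λ v → χ (suc v) ∧ δ (suc s) (suc v))
    ≡⟨ cong₂ _xor_ (Bool.∧-zeroʳ (χ zero))
         (xorSum-cong (λ v → cong (χ (suc v) ∧_) (⌊⌋-map′ _ _ (s ≟ v)))) ⟩
  xorSum (λ v → χ (suc v) ∧ δ s v) ≡⟨ xorSum-δ (χ ∘ suc) s ⟩
  χ (suc s) ∎
  where open ≡-Reasoning

xorSum-δ⊕δ : ∀ {m} (χ : A m) s t → xorSum (λ v → χ v ∧ (δ s ⊕ δ t) v) ≡ χ s xor χ t
xorSum-δ⊕δ χ s t = begin
  xorSum (λ v → χ v ∧ (δ s v xor δ t v))
    ≡⟨ xorSum-cong (λ v → Bool.∧-distribˡ-xor (χ v) (δ s v) (δ t v)) ⟩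
  xorSum ((λ v → χ v ∧ δ s v) ⊕ (λ v → χ v ∧ δ t v)) ≡⟨ xorSum-⊕ (λ v → χ v ∧ δ s v) _ ⟩
  xorSum (λ v → χ v ∧ δ s v) xor xorSum (λ v → χ v ∧ δ t v)
    ≡⟨ cong₂ _xor_ (xorSum-δ χ s) (xorSum-δ χ t) ⟩
  χ s xor χ t ∎
  where open ≡-Reasoning

-- Exchanging the two sums shows that `cut χ` is the coboundary of `χ`. This is the bridge between
-- boundaries of chains and cuts.
∂-adjoint : ∀ (G : Graph) (χ : A (nV G)) (p : A (nE G)) →
            xorSum (λ v → χ v ∧ ∂ G p v) ≡ xorSum (λ e → p e ∧ cut χ (ends G e))
∂-adjoint G χ p = begin
  xorSum (λ v → χ v ∧ xorSum (λ e → p e ∧ b e v))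
    ≡⟨ xorSum-cong (λ v → ∧-xorSum (χ v) (λ e → p e ∧ b e v)) ⟩
  xorSum (λ v → xorSum (λ e → χ v ∧ (p e ∧ b e v)))
    ≡⟨ xorSum-swap (λ v e → χ v ∧ (p e ∧ b e v)) ⟩
  xorSum (λ e → xorSum (λ v → χ v ∧ (p e ∧ b e v)))
    ≡⟨ xorSum-cong (λ e → xorSum-cong (λ v → x∙yz≈y∙xz (χ v) (p e) (b e v))) ⟩
  xorSum (λ e → xorSum (λ v → p e ∧ (χ v ∧ b e v)))
    ≡⟨ xorSum-cong (λ e → ∧-xorSum (p e) (λ v → χ v ∧ b e v)) ⟨
  xorSum (λ e → p e ∧ xorSum (λ v → χ v ∧ b e v))
    ≡⟨ xorSum-cong (λ e → cong (p e ∧_) (xorSum-δ⊕δ χ (proj₁ (ends G e)) (proj₂ (ends G e)))) ⟩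
  xorSum (λ e → p e ∧ cut χ (ends G e)) ∎
  where
  open ≡-Reasoning
  open import Algebra.Properties.CommutativeSemigroup
    (CommutativeRing.*-commutativeSemigroup Bool.xor-∧-commutativeRing) using (x∙yz≈y∙xz)
  b : Fin (nE G) → A (nV G)
  b e = δ (proj₁ (ends G e)) ⊕ δ (proj₂ (ends G e))

count-tabulate : ∀ {m} {X : Set} (q : X → Bool) (f : Fin m → X) →
                 sum (map (bit ∘ q) (tabulate f)) ≡ count (q ∘ f)
count-tabulate {zero}  q f = refl
count-tabulate {suc m} q f = cong (bit (q (f zero)) +_) (count-tabulate q (f ∘ suc))

odd-count : ∀ {m} (p : A m) → odd (count p) ≡ xorSum p
odd-count {zero}  p = refl
odd-count {suc m} p = trans (odd-+ (bit (p zero)) _)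
  (cong₂ _xor_ (odd-bit (p zero)) (odd-count (p ∘ suc)))

odd-even : ∀ {m} → 2 ∣ m → odd m ≡ false
odd-even (divides q refl) = even q
  where
  even : ∀ q → odd (q * 2) ≡ false
  even zero    = refl
  even (suc q) = trans (Bool.not-involutive _) (even q)

colour-tabulate : ∀ {m} {X : Set} (f : Fin m → X) (C : List (ℕ × X)) → map proj₂ C ≡ tabulate f →
                  Σ[ col ∈ (Fin m → ℕ) ] C ≡ tabulate (λ i → col i , f i)
colour-tabulate {zero}  f []      eq = (λ ()) , refl
colour-tabulate {suc m} f ((i , x) ∷ C) eq
  with refl , eqs ← ∷-injective eq
  with col , refl ← colour-tabulate (f ∘ suc) C eqs =
  (λ { zero → i ; (suc j) → col j }) , refl

map-≡⇒∈-≡ : {X Y : Set} {f g : X → Y} {xs : List X} → map f xs ≡ map g xs →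
            ∀ {x} → x ∈ xs → f x ≡ g x
map-≡⇒∈-≡ eq (here refl)  = proj₁ (∷-injective eq)
map-≡⇒∈-≡ eq (there x∈xs) = map-≡⇒∈-≡ (proj₂ (∷-injective eq)) x∈xs

-- The boundary of the sum of all edges is the degree modulo 2: without loops, incidence by `∨`
-- agrees with `xor`.
∂-total : ∀ (G : Graph) v → 2 ∣ degree G v → ∂ G (λ _ → true) v ≡ false
∂-total G v even = trans (xorSum-cong λ e → sym (incident-xor e))
  (trans (sym (odd-count (λ e → incident G e v))) (odd-even even))
  where
  incident-xor : ∀ e → incident G e v ≡ δ (proj₁ (ends G e)) v xor δ (proj₂ (ends G e)) v
  incident-xor e with proj₁ (ends G e) ≟ v | proj₂ (ends G e) ≟ v
  ... | yes s≡v | yes t≡v = contradiction (trans s≡v (sym t≡v)) (loopless G e)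
  ... | yes _   | no _    = refl
  ... | no _    | yes _   = refl
  ... | no _    | no _    = refl

-- From the graph to its edge list and back.

module GraphPacking (G : Graph) (v₁ v₂ v₃ v₄ : Fin (nV G)) where

  open Terminals v₁ v₂ v₃ v₄
  open DecMembership {A = Fin (nV G)} _≟_ using (_∈?_)

  edges : List (Edge (nV G))
  edges = tabulate (ends G)

  target : A (nV G)
  target = δ v₁ ⊕ δ v₂ ⊕ δ v₃ ⊕ δ v₄

  τ-xor : ∀ χ → τ χ ≡ ((χ v₁ xor χ v₂) xor χ v₃) xor χ v₄
  τ-xor χ = table (χ v₁) (χ v₂) (χ v₃) (χ v₄)
    where
    table : ∀ w x y z → parity (w ∷ x ∷ y ∷ z ∷ []) ≡ ((w xor x) xor y) xor z
    table = toWitness {a? = ∀Bool? λ _ → ∀Bool? λ _ → ∀Bool? λ _ → ∀Bool? λ _ → _ Bool.≟ _} _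

  xorSum-target : ∀ χ → xorSum (λ v → χ v ∧ target v) ≡ τ χ
  xorSum-target χ = begin
    xorSum (λ v → χ v ∧ target v)
      ≡⟨ xorSum-cong (λ v → trans (cong (χ v ∧_) (Bool.xor-assoc (δ v₁ v xor δ v₂ v) (δ v₃ v) (δ v₄ v)))
                                  (Bool.∧-distribˡ-xor (χ v) _ _)) ⟩
    xorSum ((λ v → χ v ∧ (δ v₁ ⊕ δ v₂) v) ⊕ (λ v → χ v ∧ (δ v₃ ⊕ δ v₄) v))
      ≡⟨ xorSum-⊕ (λ v → χ v ∧ (δ v₁ ⊕ δ v₂) v) _ ⟩
    xorSum (λ v → χ v ∧ (δ v₁ ⊕ δ v₂) v) xor xorSum (λ v → χ v ∧ (δ v₃ ⊕ δ v₄) v)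
      ≡⟨ cong₂ _xor_ (xorSum-δ⊕δ χ v₁ v₂) (xorSum-δ⊕δ χ v₃ v₄) ⟩
    (χ v₁ xor χ v₂) xor (χ v₃ xor χ v₄) ≡⟨ Bool.xor-assoc (χ v₁ xor χ v₂) (χ v₃) (χ v₄) ⟨
    ((χ v₁ xor χ v₂) xor χ v₃) xor χ v₄ ≡⟨ τ-xor χ ⟨
    τ χ ∎
    where open ≡-Reasoning

  -- Deleting the edges of a T-odd cut leaves no chain with boundary v₁ + v₂ + v₃ + v₄.
  edges-connected : ∀ k →
    ((D : A (nE G)) → count D < k → Σ[ p ∈ A (nE G) ] AvoidsEdges D p × ∂ G p ≐ target) →
    Connected k edges
  edges-connected k robust with Connected? k edges
  ... | inj₁ conn = conn
  ... | inj₂ (χ , τχ , few)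
    with p , avoids , ∂p ← robust (λ e → cut χ (ends G e))
           (subst (_< k) (count-tabulate (cut χ) (ends G)) few) =
    contradiction (trans (sym τχ) τχ-even) λ ()
    where
    no-crossing : ∀ e → p e ∧ cut χ (ends G e) ≡ false
    no-crossing e with cut χ (ends G e) in crosses
    ... | true  = trans (Bool.∧-identityʳ (p e)) (avoids e crosses)
    ... | false = Bool.∧-zeroʳ (p e)
    τχ-even : τ χ ≡ false
    τχ-even = begin
      τ χ                                   ≡⟨ xorSum-target χ ⟨
      xorSum (λ v → χ v ∧ target v)         ≡⟨ xorSum-cong (λ v → cong (χ v ∧_) (∂p v)) ⟨
      xorSum (λ v → χ v ∧ ∂ G p v)          ≡⟨ ∂-adjoint G χ p ⟩
      xorSum (λ e → p e ∧ cut χ (ends G e)) ≡⟨ xorSum-cong no-crossing ⟩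
      xorSum {nE G} (λ _ → false)           ≡⟨ xorSum-false (nE G) ⟩
      false ∎
      where open ≡-Reasoning

  -- Modulo 2 a cut is the sum of the degrees inside it. Vertices outside `T` contribute nothing, so
  -- only the trace on `T` counts.
  edges-balanced : (∀ y → y ∉ T → 2 ∣ degree G y) → Balanced edges
  edges-balanced even χ ψ eq = trans (odd-size χ) (trans (xorSum-cong same) (sym (odd-size ψ)))
    where
    odd-size : ∀ χ → odd (size χ edges) ≡ xorSum (λ v → χ v ∧ ∂ G (λ _ → true) v)
    odd-size χ = trans (cong odd (count-tabulate (cut χ) (ends G)))
      (trans (odd-count (λ e → cut χ (ends G e))) (sym (∂-adjoint G χ (λ _ → true))))
    same : ∀ v → χ v ∧ ∂ G (λ _ → true) v ≡ ψ v ∧ ∂ G (λ _ → true) v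
    same v with v ∈? T
    ... | yes v∈T = cong (_∧ ∂ G (λ _ → true) v) (map-≡⇒∈-≡ eq v∈T)
    ... | no v∉T rewrite ∂-total G v (even v v∉T) =
      trans (Bool.∧-zeroʳ (χ v)) (sym (Bool.∧-zeroʳ (ψ v)))

  -- The chains are the colour classes. Their boundary at `v` is the parity of the cut around `{v}`,
  -- which the packing prescribes.
  Packable⇒chains : ∀ {k} → Packable k edges →
    Σ[ ps ∈ (Fin k → A (nE G)) ]
      ((i j : Fin k) → i ≢ j → NoCommonSummand (ps i) (ps j)) × ((i : Fin k) → ∂ G (ps i) ≐ target)
  Packable⇒chains {k} (C , eq , packs) with col , refl ← colour-tabulate (ends G) C eq =
    ps , disjoint , boundary
    where
    ps : Fin k → A (nE G)
    ps i e = col e ≡ᵇ toℕ i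
    coloured : ∀ i e → ps i e ≡ true → col e ≡ toℕ i
    coloured i e eq = ≡ᵇ⇒≡ (col e) (toℕ i) (Equivalence.from Bool.T-≡ eq)
    disjoint : (i j : Fin k) → i ≢ j → NoCommonSummand (ps i) (ps j)
    disjoint i j i≢j e e∈i = Bool.¬-not λ e∈j →
      i≢j (toℕ-injective (trans (sym (coloured i e e∈i)) (coloured j e e∈j)))
    boundary : (i : Fin k) → ∂ G (ps i) ≐ target
    boundary i v = begin
      xorSum (λ e → ps i e ∧ cut (ind v) (ends G e))
        ≡⟨ odd-count (λ e → ps i e ∧ cut (ind v) (ends G e)) ⟨
      odd (count (λ e → ps i e ∧ cut (ind v) (ends G e)))
        ≡⟨ cong odd (count-tabulate (λ ce → (proj₁ ce ≡ᵇ toℕ i) ∧ cut (ind v) (proj₂ ce))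
             (λ e → col e , ends G e)) ⟨
      odd (load (toℕ i) (ind v) (tabulate (λ e → col e , ends G e)))
        ≡⟨ packs (toℕ i) (ind v) (toℕ<n i) ⟩
      τ (ind v)  ≡⟨ τ-xor (ind v) ⟩
      target v   ∎
      where open ≡-Reasoning

theorem2p9 : (k : ℕ) → 1 ≤ k → (G : Graph) → (v₁ v₂ v₃ v₄ : Fin (nV G)) →
    v₁ ≢ v₂ → v₁ ≢ v₃ → v₁ ≢ v₄ → v₂ ≢ v₃ → v₂ ≢ v₄ → v₃ ≢ v₄ →
    ((y : Fin (nV G)) → y ≢ v₁ → y ≢ v₂ → y ≢ v₃ → y ≢ v₄ → 2 ∣ degree G y) →
    ((D : A (nE G)) → count D < k →
    Σ (A (nE G)) (λ p → AvoidsEdges D p × (∂ G p ≐ δ v₁ ⊕ δ v₂ ⊕ δ v₃ ⊕ δ v₄))) →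
    Σ (Fin k → A (nE G)) (λ ps →
    ((i j : Fin k) → i ≢ j → NoCommonSummand (ps i) (ps j)) ×
    ((i : Fin k) → ∂ G (ps i) ≐ δ v₁ ⊕ δ v₂ ⊕ δ v₃ ⊕ δ v₄))
theorem2p9 k _ G v₁ v₂ v₃ v₄ 1≢2 1≢3 1≢4 2≢3 2≢4 3≢4 even robust =
  Packable⇒chains (pack (length edges) k ≤-refl (edges-connected k robust)
    (edges-balanced even-off-T))
  where
  open GraphPacking G v₁ v₂ v₃ v₄
  open Terminals v₁ v₂ v₃ v₄ using (T; module Pack)
  open Pack ((1≢2 ∷ 1≢3 ∷ 1≢4 ∷ []) ∷ (2≢3 ∷ 2≢4 ∷ []) ∷ (3≢4 ∷ []) ∷ [] ∷ []) using (pack)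
  even-off-T : ∀ y → y ∉ T → 2 ∣ degree G y
  even-off-T y y∉T = even y (y∉T ∘ here) (y∉T ∘ there ∘ here) (y∉T ∘ there ∘ there ∘ here)
    (y∉T ∘ there ∘ there ∘ there ∘ here)
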